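{- For every $\varepsilon>0$ there exists a unit-cost $k$-of-$n$ instance $I$ of Stochastic Score Classification (i.e., $B=2$, $c_j=1$ for all $j$, and $p_j\in(0,1)$ for all $j$) such that $$\mathbb{E}[\mathrm{cost}(\overline{\mathrm{OPT}},I)]\ge\left(\tfrac32-\varepsilon\right)\cdot\mathbb{E}[\mathrm{cost}(\mathrm{OPT},I)],$$ where $\overline{\mathrm{OPT}}$ is an optimal non-adaptive strategy and $\mathrm{OPT}$ an optimal adaptive strategy for $I$.
   Context: An instance $I$ of Stochastic Score Classification (SSC) consists of tests $N=\{1,\dots,n\}$, costs $c_j\ge 0$, success probabilities $p_j\in(0,1)$, and integers $0=t_1<t_2<\dots<t_B<t_{B+1}=n+1$. The outcome vector $x\in\{0,1\}^N$ has independent coordinates with $\Pr[x_j=1]=p_j$. The score $f(x)$ is the unique $i$ with $t_i\le\|x\|_1\le t_{i+1}-1$. A $k$-of-$n$ instance is one with $B=2$ and $t_2=k$. A (possibly adaptive) strategy conducts tests one at a time, each at most once, the choice of the next test possibly depending on outcomes observed so far, and stops as soon as $f(x)$ is determined (all $x'$ agreeing with $x$ on the conducted tests have $f(x')=f(x)$). A non-adaptive strategy is a fixed permutation of $N$: tests are conducted in this order until $f(x)$ is determined. $\mathrm{cost}(S,I)$ is the random total cost of tests conducted by $S$. $\mathrm{OPT}$ (resp. $\overline{\mathrm{OPT}}$) minimizes $\mathbb{E}[\mathrm{cost}(S,I)]$ over all adaptive (resp. non-adaptive) strategies. -}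

module Defs where

open import Data.Bool.Base using (Bool; true; false; if_then_else_)
open import Data.Empty using (⊥-elim)
open import Data.Fin.Base as Fin using (Fin; zero; suc; inject₁; fromℕ; toℕ)
import Data.Fin.Properties as Fin
open import Data.Fin.Permutation using (Permutation′; _⟨$⟩ʳ_)
open import Data.Fin.Subset using (Subset; _∈_; _∉_; _∪_; ⁅_⁆; ⊥; ∣_∣)
open import Data.Fin.Subset.Properties using (_∈?_; anySubset?; ∣p∣≤n)
open import Data.List.Base as List using (List; []; _∷_; _++_)
open import Data.Nat.Base as ℕ using (ℕ; zero; suc; z≤n; s≤s)
import Data.Nat.Properties as ℕ
open import Data.Product using (∃; ∃!; _×_; _,_; proj₁)
open import Data.Rational.Base using (ℚ; 0ℚ; 1ℚ; _+_; _*_; _-_; _≤_; _<_)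
open import Data.Sum.Base using (_⊎_; inj₁; inj₂)
open import Data.Vec.Base as Vec using (Vec; lookup)
import Data.Vec.Functional as Vector
import Data.Bool.Properties as Bool
open import Level using (0ℓ)
open import Relation.Binary.Definitions using (tri<; tri≈; tri>)
open import Relation.Binary.PropositionalEquality
  using (_≡_; refl; sym; subst; cong)
open import Relation.Nullary.Decidable
  using (Dec; yes; no; does; map′; ¬?; _→-dec_; decidable-stable)
open import Relation.Unary using (Pred; Decidable)

private variable
  n B : ℕ

-- Tests are numbered from 0, and so are the thresholds and scores: the
-- thresholds t₁ < … < t_{B+1} are t zero, …, t (fromℕ B), and the scores
-- 1, …, B are the elements of Fin B.

record Instance (n B : ℕ) : Set where
  field
    c        : Fin n → ℚ
    c-nonneg : ∀ j → 0ℚ ≤ c j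
    p        : Fin n → ℚ
    p-pos    : ∀ j → 0ℚ < p j
    p-<1     : ∀ j → p j < 1ℚ
    t        : Fin (suc B) → ℕ
    t-mono   : ∀ {i j} → i Fin.< j → t i ℕ.< t j
    t-first  : t zero ≡ 0
    t-last   : t (fromℕ B) ≡ suc n

open Instance public

UnitCost : Instance n B → Set
UnitCost I = ∀ j → c I j ≡ 1ℚ

IsKOfN : ℕ → Instance n 2 → Set
IsKOfN k I = t I (suc zero) ≡ k

Outcome : ℕ → Set
Outcome = Vec Bool

-- ∣ x ∣ counts the entries of x equal to true, i.e. it is ‖x‖₁.
HasScore : Instance n B → Outcome n → Fin B → Set
HasScore I x i = t I (inject₁ i) ℕ.≤ ∣ x ∣ × ∣ x ∣ ℕ.< t I (suc i)

private
  bracket : ∀ B (t : Fin (suc B) → ℕ) s → t zero ℕ.≤ s → s ℕ.< t (fromℕ B) →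
            ∃ λ (i : Fin B) → t (inject₁ i) ℕ.≤ s × s ℕ.< t (suc i)
  bracket zero    t s lo hi = ⊥-elim (ℕ.<-irrefl refl (ℕ.≤-<-trans lo hi))
  bracket (suc B) t s lo hi with s ℕ.<? t (suc zero)
  ... | yes s<t = zero , lo , s<t
  ... | no  s≮t with bracket B (λ i → t (suc i)) s (ℕ.≮⇒≥ s≮t) hi
  ...   | i , lo′ , hi′ = suc i , lo′ , hi′

  disjoint : (I : Instance n B) (x : Outcome n) {i j : Fin B} →
             i Fin.< j → HasScore I x i → HasScore I x j → i ≡ j
  disjoint I x {i} {j} i<j (_ , hi) (lo , _) =
    ⊥-elim (ℕ.<-irrefl refl (ℕ.<-≤-trans hi (ℕ.≤-trans (t≤ (ℕ.m≤n⇒m<n∨m≡n i<j′)) lo)))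
    where
    i<j′ : toℕ (suc i) ℕ.≤ toℕ (inject₁ j)
    i<j′ = subst (suc (toℕ i) ℕ.≤_) (sym (Fin.toℕ-inject₁ j)) i<j
    t≤ : toℕ (suc i) ℕ.< toℕ (inject₁ j) ⊎ toℕ (suc i) ≡ toℕ (inject₁ j) →
         t I (suc i) ℕ.≤ t I (inject₁ j)
    t≤ (inj₁ lt) = ℕ.<⇒≤ (t-mono I lt)
    t≤ (inj₂ eq) = ℕ.≤-reflexive (cong (t I) (Fin.toℕ-injective eq))

score-exists-unique : (I : Instance n B) (x : Outcome n) → ∃! _≡_ (HasScore I x)
score-exists-unique {n} {B} I x
  with bracket B (t I) ∣ x ∣
         (subst (ℕ._≤ ∣ x ∣) (sym (t-first I)) z≤n)
         (subst (∣ x ∣ ℕ.<_) (sym (t-last I)) (s≤s (∣p∣≤n x)))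
... | i , h = i , h , unique
  where
  unique : ∀ {j} → HasScore I x j → i ≡ j
  unique {j} h′ with Fin.<-cmp i j
  ... | tri< i<j _ _ = disjoint I x i<j h h′
  ... | tri≈ _ i≡j _ = i≡j
  ... | tri> _ _ j<i = sym (disjoint I x j<i h′ h)

score : Instance n B → Outcome n → Fin B
score I x = proj₁ (score-exists-unique I x)

-- S is the set of tests conducted so far and x the true outcome vector, of
-- which only the coordinates in S have been observed.

Agree : Subset n → Outcome n → Outcome n → Set
Agree S x x′ = ∀ j → j ∈ S → lookup x′ j ≡ lookup x j

Determined : Instance n B → Subset n → Outcome n → Set
Determined I S x = ∀ x′ → Agree S x x′ → score I x′ ≡ score I x

private
  allOutcomes? : {P : Pred (Outcome n) 0ℓ} → Decidable P → Dec (∀ x → P x)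
  allOutcomes? P? = map′
    (λ ¬∃¬ x → decidable-stable (P? x) λ ¬p → ¬∃¬ (x , ¬p))
    (λ ∀p (x , ¬p) → ¬p (∀p x))
    (¬? (anySubset? λ x → ¬? (P? x)))

determined? : (I : Instance n B) (S : Subset n) (x : Outcome n) →
              Dec (Determined I S x)
determined? I S x = allOutcomes? λ x′ →
  Fin.all? (λ j → (j ∈? S) →-dec (lookup x′ j Bool.≟ lookup x j))
  →-dec (score I x′ Fin.≟ score I x)

-- A strategy is a decision tree, indexed by the tests already conducted on
-- the way to its root.  The tree branches until every test is conducted; the
-- stopping rule is imposed in `cost`, so whatever lies beyond the point where
-- the score is determined is never executed.

data AdaptiveFrom {n : ℕ} (S : Subset n) : Set where
  end  : (∀ j → j ∈ S) → AdaptiveFrom S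
  test : ∀ j → j ∉ S → (Bool → AdaptiveFrom (S ∪ ⁅ j ⁆)) → AdaptiveFrom S

Adaptive : ℕ → Set
Adaptive n = AdaptiveFrom {n} ⊥

costFrom : Instance n B → (S : Subset n) → AdaptiveFrom S → Outcome n → ℚ
costFrom I S (end _)         x = 0ℚ
costFrom I S (test j _ next) x =
  if does (determined? I S x)
  then 0ℚ
  else c I j + costFrom I (S ∪ ⁅ j ⁆) (next (lookup x j)) x

cost : Instance n B → Adaptive n → Outcome n → ℚ
cost I = costFrom I ⊥

-- π ⟨$⟩ʳ i is the test in position i.
NonAdaptive : ℕ → Set
NonAdaptive = Permutation′

costInOrder : Instance n B → Subset n → List (Fin n) → Outcome n → ℚ
costInOrder I S []       x = 0ℚ
costInOrder I S (j ∷ js) x =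
  if does (determined? I S x)
  then 0ℚ
  else c I j + costInOrder I (S ∪ ⁅ j ⁆) js x

costᴺ : Instance n B → NonAdaptive n → Outcome n → ℚ
costᴺ I π = costInOrder I ⊥ (List.tabulate (π ⟨$⟩ʳ_))

outcomes : ∀ n → List (Outcome n)
outcomes zero    = Vec.[] ∷ []
outcomes (suc n) = List.map (true Vec.∷_) (outcomes n)
                ++ List.map (false Vec.∷_) (outcomes n)

Pr : Instance n B → Outcome n → ℚ
Pr I x = Vector.foldr _*_ 1ℚ λ j → if lookup x j then p I j else 1ℚ - p I j

𝔼 : Instance n B → (Outcome n → ℚ) → ℚ
𝔼 {n} I X = List.foldr _+_ 0ℚ (List.map (λ x → Pr I x * X x) (outcomes n))

IsOPT : Instance n B → Adaptive n → Set
IsOPT I T = ∀ T′ → 𝔼 I (cost I T) ≤ 𝔼 I (cost I T′)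

IsOPTᴺ : Instance n B → NonAdaptive n → Set
IsOPTᴺ I π = ∀ π′ → 𝔼 I (costᴺ I π) ≤ 𝔼 I (costᴺ I π′)

{-# OPTIONS --safe #-}
module Submission where

-- Take k = m + 1 and n = 2m + 1: one fair test, m tests that succeed and m
-- tests that fail with probability 1 - δ.  For small δ essentially only two
-- outcomes occur, those where every skewed test has its likely result.  If the
-- fair test succeeds, the m + 1 successes form the only certificate; if it
-- fails, the m + 1 failures do.  Probing the fair test first tells which one is
-- needed, for an adaptive cost of m + 1.  A fixed order pays 2m + 1 on the
-- outcome whose certificate contains its last test and at least m + 1 on the
-- other, on average (3m + 2)/2.

open import Defs
open import Data.Bool.Base using (Bool; true; false; if_then_else_)
open import Data.Fin.Base as Fin using (Fin; zero; suc; toℕ; fromℕ; punchIn)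
open import Data.Fin.Permutation as Perm
  using (Permutation′; _⟨$⟩ʳ_; _⟨$⟩ˡ_; _≈_)
import Data.Fin.Properties as Fin
open import Data.Fin.Subset using (Subset; _∈_; _∉_; _∪_; _⊆_; ⁅_⁆; ⊥; ∁; ∣_∣)
open import Data.Fin.Subset.Properties as Sub using (_∈?_)
open import Data.Integer.Base as ℤ using (+_; +[1+_]; -[1+_])
import Data.Integer.Properties as ℤ
open import Data.List.Base as List using (List; []; _∷_; _++_)
import Data.List.Membership.Propositional as List
import Data.List.Membership.Propositional.Properties as List
import Data.List.Properties as List
open import Data.List.Relation.Unary.Any as Any using (Any; here; there)
import Data.List.Relation.Unary.Any.Properties as Any
open import Data.Nat.Base as ℕ using (ℕ; zero; suc; z≤n; s≤s)
import Data.Nat.Properties as ℕ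
open import Data.Product.Base using (Σ-syntax; _×_; _,_; proj₁; proj₂)
open import Data.Rational.Base
  using (ℚ; mkℚ; 0ℚ; 1ℚ; ½; _/_; _-_; _+_; _*_; -_; 1/_; _<_; _≤_; _≥_;
         *≤*; *<*; toℚᵘ; nonNegative; positive)
import Data.Rational.Properties as ℚ
open import Data.Rational.Solver using (module +-*-Solver)
import Data.Rational.Unnormalised.Base as ℚᵘ
import Data.Rational.Unnormalised.Properties as ℚᵘ
open import Data.Sum.Base using (_⊎_; inj₁; inj₂)
open import Data.Vec.Base as Vec using (lookup; _[_]≔_; here; there)
import Data.Vec.Functional as Vector
import Data.Vec.Properties as Vec
open import Function.Base using (_∘_; id)
open import Function.Bundles using (_⇔_; mk⇔; Equivalence)
open import Function.Definitions using (Injective)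
open import Relation.Binary.Bundles using (module DecTotalOrder)
open import Relation.Binary.PropositionalEquality
  using (_≡_; _≢_; refl; sym; trans; cong; cong₂; subst; module ≡-Reasoning)
open import Relation.Nullary using (¬_; Dec; does; yes; no; contradiction)
open +-*-Solver using (solve; con; _:+_; _:-_; _:*_; _:=_)
import Data.List.Extrema (DecTotalOrder.totalOrder ℚ.≤-decTotalOrder) as Extrema

private variable
  n N : ℕ
  A : Set

-- Order lemmas for the rationals and the embedding of ℕ.

0≤ : ∀ {a b} → a ≤ b → 0ℚ ≤ b - a
0≤ {a} {b} a≤b = ℚ.≤-trans (ℚ.≤-reflexive (sym (ℚ.+-inverseʳ a))) (ℚ.+-monoˡ-≤ (- a) a≤b)

-- The form in which the later polynomial inequalities are proved: `r` is an explicit combination of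
-- nonnegative terms, and the ring solver checks the equation.
0≤⇒≤ : ∀ {a b r} → 0ℚ ≤ r → b ≡ a + r → a ≤ b
0≤⇒≤ {a} {b} {r} 0≤r eq = ℚ.≤-trans (ℚ.≤-reflexive (sym (ℚ.+-identityʳ a)))
  (ℚ.≤-trans (ℚ.+-monoʳ-≤ a 0≤r) (ℚ.≤-reflexive (sym eq)))

+-nonneg : ∀ {a b} → 0ℚ ≤ a → 0ℚ ≤ b → 0ℚ ≤ a + b
+-nonneg 0≤a 0≤b = ℚ.+-mono-≤ 0≤a 0≤b

*-nonneg : ∀ {a b} → 0ℚ ≤ a → 0ℚ ≤ b → 0ℚ ≤ a * b
*-nonneg {a} {b} 0≤a 0≤b =
  ℚ.nonNegative⁻¹ (a * b)
    {{ℚ.nonNeg*nonNeg⇒nonNeg a {{nonNegative 0≤a}} b {{nonNegative 0≤b}}}}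

-- Recursive rather than `+ n / 1`, which normalises by a gcd and is stuck on open terms; here one
-- more unit cost is definitionally `ι (suc n)`.
ι : ℕ → ℚ
ι zero    = 0ℚ
ι (suc n) = 1ℚ + ι n

0≤1 : 0ℚ ≤ 1ℚ
0≤1 = *≤* (ℤ.+≤+ z≤n)

0≤½ : 0ℚ ≤ ½
0≤½ = *≤* (ℤ.+≤+ z≤n)

0≤ι : ∀ n → 0ℚ ≤ ι n
0≤ι zero    = ℚ.≤-refl
0≤ι (suc n) = +-nonneg 0≤1 (0≤ι n)

ι-mono : ∀ {m n} → m ℕ.≤ n → ι m ≤ ι n
ι-mono {n = n} z≤n = 0≤ι n
ι-mono (s≤s m≤n) = ℚ.+-monoʳ-≤ 1ℚ (ι-mono m≤n)

ι-+ : ∀ m n → ι (m ℕ.+ n) ≡ ι m + ι n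
ι-+ zero    n = sym (ℚ.+-identityˡ (ι n))
ι-+ (suc m) n = trans (cong (_+_ 1ℚ) (ι-+ m n)) (sym (ℚ.+-assoc 1ℚ (ι m) (ι n)))

ι-* : ∀ m n → ι (m ℕ.* n) ≡ ι m * ι n
ι-* zero    n = sym (ℚ.*-zeroˡ (ι n))
ι-* (suc m) n = begin
  ι (n ℕ.+ m ℕ.* n)  ≡⟨ ι-+ n (m ℕ.* n) ⟩
  ι n + ι (m ℕ.* n)  ≡⟨ cong (_+_ (ι n)) (ι-* m n) ⟩
  ι n + ι m * ι n    ≡⟨ solve 2 (λ a b → b :+ a :* b := (con 1ℚ :+ a) :* b) refl (ι m) (ι n) ⟩
  (1ℚ + ι m) * ι n   ∎
  where open ≡-Reasoning

toℚᵘ-ι : ∀ n → toℚᵘ (ι n) ℚᵘ.≃ ℚᵘ.mkℚᵘ (+ n) 0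
toℚᵘ-ι zero    = ℚᵘ.≃-refl
toℚᵘ-ι (suc n) = ℚᵘ.≃-trans (ℚ.toℚᵘ-homo-+ 1ℚ (ι n))
  (ℚᵘ.≃-trans (ℚᵘ.+-congʳ (toℚᵘ 1ℚ) (toℚᵘ-ι n))
    (ℚᵘ.*≡* (cong (ℤ._* + 1) (cong (λ z → + 1 ℤ.+ z) (ℤ.*-identityʳ (+ n))))))

-- The multiplier is the denominator of ε itself, so the product is its numerator, a positive
-- integer.
archimedean : ∀ ε → 0ℚ < ε → Σ[ d ∈ ℕ ] 1ℚ ≤ ε * ι d
archimedean ε@(mkℚ +[1+ a ] d _) _ = suc d , ℚ.toℚᵘ-cancel-≤ (ℚᵘ.≤-respʳ-≃ (ℚᵘ.≃-sym
    (ℚᵘ.≃-trans (ℚ.toℚᵘ-homo-* ε (ι (suc d))) (ℚᵘ.*-congˡ {toℚᵘ ε} (toℚᵘ-ι (suc d)))))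
    (ℚᵘ.*≤* (ℤ.+≤+ le)))
  where
  le : suc (d ℕ.* 1 ℕ.+ 0) ℕ.≤ suc ((d ℕ.+ a ℕ.* suc d) ℕ.* 1)
  le = s≤s (ℕ.≤-trans (ℕ.≤-reflexive (ℕ.+-identityʳ (d ℕ.* 1)))
    (ℕ.*-monoˡ-≤ 1 (ℕ.m≤m+n d (a ℕ.* suc d))))
archimedean (mkℚ (+ 0)    _ _) (*<* (ℤ.+<+ ()))
archimedean (mkℚ -[1+ _ ] _ _) (*<* ())

0<ι-suc : ∀ n → 0ℚ < ι (suc n)
0<ι-suc n = ℚ.+-mono-<-≤ 0<1 (0≤ι n)
  where
  0<1 : 0ℚ < 1ℚ
  0<1 = *<* (ℤ.+<+ (s≤s z≤n))

reciprocal : ∀ d → Σ[ δ ∈ ℚ ] 0ℚ < δ × δ * ι (suc d) ≡ 1ℚ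
reciprocal d = 1/ ι (suc d) , ℚ.positive⁻¹ _ {{ℚ.1/pos⇒pos (ι (suc d))}} , ℚ.*-inverseˡ (ι (suc d))
  where
  instance
    _ = positive (0<ι-suc d)
    _ = ℚ.pos⇒nonZero (ι (suc d))

reciprocal-<1 : ∀ {δ} d → 0ℚ < δ → δ * ι (suc (suc d)) ≡ 1ℚ → δ < 1ℚ
reciprocal-<1 {δ} d 0<δ eq = subst (δ <_) eq′ (subst (_< δ + δ * (1ℚ + ι d)) (ℚ.+-identityʳ δ)
    (ℚ.+-monoʳ-< δ (ℚ.positive⁻¹ _ {{ℚ.pos*pos⇒pos δ (1ℚ + ι d)}})))
  where
  instance
    _ = positive 0<δ
    _ = positive (0<ι-suc d)
  eq′ : δ + δ * (1ℚ + ι d) ≡ 1ℚ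
  eq′ = trans (solve 2 (λ a b → a :+ a :* b := a :* (con 1ℚ :+ b)) refl δ (1ℚ + ι d)) eq

-- Expectation under independent coordinates.

-- `Pr` and `𝔼` use only the probabilities of an instance. Stated for the vector `p` alone, they
-- admit induction on the number of tests, and `𝔼 I` is definitionally `E (p I)`.
weight : (Fin n → ℚ) → Outcome n → ℚ
weight p x = Vector.foldr _*_ 1ℚ λ j → if lookup x j then p j else 1ℚ - p j

∑ : (A → ℚ) → List A → ℚ
∑ f xs = List.foldr _+_ 0ℚ (List.map f xs)

E : (Fin n → ℚ) → (Outcome n → ℚ) → ℚ
E {n} p X = ∑ (λ x → weight p x * X x) (outcomes n)

∑-++ : (f : A → ℚ) (xs ys : List A) → ∑ f (xs ++ ys) ≡ ∑ f xs + ∑ f ys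
∑-++ f []       ys = sym (ℚ.+-identityˡ (∑ f ys))
∑-++ f (x ∷ xs) ys = trans (cong (_+_ (f x)) (∑-++ f xs ys)) (sym (ℚ.+-assoc (f x) (∑ f xs) (∑ f ys)))

∑-map-* : ∀ {B : Set} c (f : B → ℚ) (g : A → ℚ) (h : A → B) → (∀ x → f (h x) ≡ c * g x) →
          ∀ xs → ∑ f (List.map h xs) ≡ c * ∑ g xs
∑-map-* c f g h eq []       = sym (ℚ.*-zeroʳ c)
∑-map-* c f g h eq (x ∷ xs) =
  trans (cong₂ _+_ (eq x) (∑-map-* c f g h eq xs)) (sym (ℚ.*-distribˡ-+ c (g x) (∑ g xs)))

E-suc : (p : Fin (suc n) → ℚ) (X : Outcome (suc n) → ℚ) →
        E p X ≡ p zero * E (p ∘ suc) (X ∘ (true Vec.∷_)) +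
                (1ℚ - p zero) * E (p ∘ suc) (X ∘ (false Vec.∷_))
E-suc {n} p X =
  trans (∑-++ _ (List.map (true Vec.∷_) (outcomes n)) (List.map (false Vec.∷_) (outcomes n)))
    (cong₂ _+_ (branch (p zero) true (λ _ → refl)) (branch (1ℚ - p zero) false (λ _ → refl)))
  where
  p′ = p ∘ suc
  branch : ∀ q b → (∀ x → weight p (b Vec.∷ x) ≡ q * weight p′ x) →
           ∑ (λ x → weight p x * X x) (List.map (b Vec.∷_) (outcomes n)) ≡ q * E p′ (X ∘ (b Vec.∷_))
  branch q b eq = ∑-map-* q _ (λ x → weight p′ x * X (b Vec.∷ x)) (b Vec.∷_)
    (λ x → trans (cong (_* X (b Vec.∷ x)) (eq x)) (ℚ.*-assoc q (weight p′ x) (X (b Vec.∷ x)))) (outcomes n)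

E-cong : (p : Fin n → ℚ) {X Y : Outcome n → ℚ} → (∀ x → X x ≡ Y x) → E p X ≡ E p Y
E-cong p eq = cong (List.foldr _+_ 0ℚ) (List.map-cong (λ x → cong (weight p x *_) (eq x)) (outcomes _))

-- The constant survives because the weights total 1, a fact that the induction proves implicitly.
-- This turns a lower bound on an expected saving into an upper bound on an expected cost.
E-complement : ∀ (p : Fin n → ℚ) X a → E p (λ x → a - X x) ≡ a - E p X
E-complement {zero} p X a =
  solve 2 (λ a x → con 1ℚ :* (a :- x) :+ con 0ℚ := a :- (con 1ℚ :* x :+ con 0ℚ)) refl a (X Vec.[])
E-complement {suc n} p X a
  rewrite E-suc p (λ x → a - X x) | E-suc p X
        | E-complement (p ∘ suc) (X ∘ (true Vec.∷_)) a
        | E-complement (p ∘ suc) (X ∘ (false Vec.∷_)) a =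
  solve 4 (λ q a x y → q :* (a :- x) :+ (con 1ℚ :- q) :* (a :- y)
                    := a :- (q :* x :+ (con 1ℚ :- q) :* y)) refl
    (p zero) a (E (p ∘ suc) (X ∘ (true Vec.∷_))) (E (p ∘ suc) (X ∘ (false Vec.∷_)))

Probability : (Fin n → ℚ) → Set
Probability p = ∀ j → 0ℚ ≤ p j × p j ≤ 1ℚ

weight-nonneg : (p : Fin n → ℚ) → Probability p → ∀ x → 0ℚ ≤ weight p x
weight-nonneg p pr Vec.[] = 0≤1
weight-nonneg p pr (true Vec.∷ x) = *-nonneg (proj₁ (pr zero)) (weight-nonneg (p ∘ suc) (pr ∘ suc) x)
weight-nonneg p pr (false Vec.∷ x) = *-nonneg (0≤ (proj₂ (pr zero))) (weight-nonneg (p ∘ suc) (pr ∘ suc) x)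

∑-nonneg : (f : A → ℚ) → (∀ x → 0ℚ ≤ f x) → ∀ xs → 0ℚ ≤ ∑ f xs
∑-nonneg f 0≤f []       = ℚ.≤-refl
∑-nonneg f 0≤f (x ∷ xs) = +-nonneg (0≤f x) (∑-nonneg f 0≤f xs)

E-nonneg : (p : Fin n → ℚ) → Probability p → ∀ {X} → (∀ x → 0ℚ ≤ X x) → 0ℚ ≤ E p X
E-nonneg p pr 0≤X = ∑-nonneg _ (λ x → *-nonneg (weight-nonneg p pr x) (0≤X x)) (outcomes _)

weight*≤E : (p : Fin n → ℚ) → Probability p → ∀ {X} → (∀ x → 0ℚ ≤ X x) →
            ∀ x → weight p x * X x ≤ E p X
weight*≤E p pr {X} 0≤X Vec.[] = ℚ.≤-reflexive (sym (ℚ.+-identityʳ _))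
weight*≤E p pr {X} 0≤X (b Vec.∷ x) rewrite E-suc p X = go b
  where
  p′ = p ∘ suc
  Eᵇ : Bool → ℚ
  Eᵇ b = E p′ (X ∘ (b Vec.∷_))
  0≤Eᵇ : ∀ b → 0ℚ ≤ Eᵇ b
  0≤Eᵇ b = E-nonneg p′ (pr ∘ suc) (0≤X ∘ (b Vec.∷_))
  0≤rest : ∀ b → 0ℚ ≤ Eᵇ b - weight p′ x * X (b Vec.∷ x)
  0≤rest b = 0≤ (weight*≤E p′ (pr ∘ suc) (0≤X ∘ (b Vec.∷_)) x)
  0≤p₀ = proj₁ (pr zero)
  0≤1-p₀ = 0≤ (proj₂ (pr zero))
  go : ∀ b → weight p (b Vec.∷ x) * X (b Vec.∷ x) ≤ p zero * Eᵇ true + (1ℚ - p zero) * Eᵇ false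
  go true = 0≤⇒≤ (+-nonneg (*-nonneg 0≤p₀ (0≤rest true)) (*-nonneg 0≤1-p₀ (0≤Eᵇ false)))
    (solve 5 (λ q w e f z → q :* e :+ (con 1ℚ :- q) :* f
                 := (q :* w) :* z :+ (q :* (e :- w :* z) :+ (con 1ℚ :- q) :* f)) refl
       (p zero) (weight p′ x) (Eᵇ true) (Eᵇ false) (X (true Vec.∷ x)))
  go false = 0≤⇒≤ (+-nonneg (*-nonneg 0≤p₀ (0≤Eᵇ true)) (*-nonneg 0≤1-p₀ (0≤rest false)))
    (solve 5 (λ q w e f z → q :* f :+ (con 1ℚ :- q) :* e
                 := ((con 1ℚ :- q) :* w) :* z :+ (q :* f :+ (con 1ℚ :- q) :* (e :- w :* z))) refl
       (p zero) (weight p′ x) (Eᵇ false) (Eᵇ true) (X (false Vec.∷ x)))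

-- All outcomes other than the two extensions of `y` are dropped, at no loss of validity since `X`
-- is nonnegative. It is applied to the cost of a fixed order and to the saving of an adaptive
-- strategy.
branches≤E : (p : Fin (suc n) → ℚ) → Probability p → ∀ {X} → (∀ x → 0ℚ ≤ X x) → ∀ y →
  p zero * (weight (p ∘ suc) y * X (true Vec.∷ y)) +
    (1ℚ - p zero) * (weight (p ∘ suc) y * X (false Vec.∷ y)) ≤ E p X
branches≤E p pr {X} 0≤X y rewrite E-suc p X =
  0≤⇒≤ (+-nonneg (*-nonneg (proj₁ (pr zero)) (0≤ (branch true)))
                 (*-nonneg (0≤ (proj₂ (pr zero))) (0≤ (branch false))))
    (solve 5 (λ q e f u v → q :* e :+ (con 1ℚ :- q) :* f
        := (q :* u :+ (con 1ℚ :- q) :* v) :+ (q :* (e :- u) :+ (con 1ℚ :- q) :* (f :- v))) refl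
      (p zero) (E (p ∘ suc) (X ∘ (true Vec.∷_))) (E (p ∘ suc) (X ∘ (false Vec.∷_)))
      (weight (p ∘ suc) y * X (true Vec.∷ y)) (weight (p ∘ suc) y * X (false Vec.∷ y)))
  where
  branch : ∀ b → weight (p ∘ suc) y * X (b Vec.∷ y) ≤ E (p ∘ suc) (X ∘ (b Vec.∷_))
  branch b = weight*≤E (p ∘ suc) (pr ∘ suc) (0≤X ∘ (b Vec.∷_)) y

-- The weight of y is (1 - δ)ⁿ.
bernoulli : ∀ {δ} → 0ℚ ≤ δ → δ ≤ 1ℚ → (y : Outcome n) →
  1ℚ - ι n * δ ≤ weight (λ j → if lookup y j then 1ℚ - δ else δ) y
bernoulli {δ = δ} 0≤δ δ≤1 Vec.[] = ℚ.≤-reflexive (solve 1 (λ d → con 1ℚ :- con 0ℚ :* d := con 1ℚ) refl δ)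
bernoulli {suc n} {δ} 0≤δ δ≤1 (b Vec.∷ y) = 
  0≤⇒≤ (+-nonneg (*-nonneg (0≤ δ≤1) (0≤ (bernoulli 0≤δ δ≤1 y))) (*-nonneg (0≤ι n) (*-nonneg 0≤δ 0≤δ)))
    (trans (cong (_* w) (factor b))
      (solve 3 (λ d n w → (con 1ℚ :- d) :* w
         := (con 1ℚ :- (con 1ℚ :+ n) :* d) :+ ((con 1ℚ :- d) :* (w :- (con 1ℚ :- n :* d)) :+ n :* (d :* d)))
         refl δ (ι n) w))
  where
  w = weight (λ j → if lookup y j then 1ℚ - δ else δ) y
  factor : ∀ b → (if b then (if b then 1ℚ - δ else δ) else 1ℚ - (if b then 1ℚ - δ else δ)) ≡ 1ℚ - δ
  factor true  = refl
  factor false = refl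

-- Arithmetic of the two cost bounds and of their ratio.

-- The two likely outcomes have probability w/2 each, and their costs total at least N + M + 1 = 3M
-- + 2.
nonAdaptive-arithmetic : ∀ {w M N n₁ n₀ e} → 0ℚ ≤ w → N ≡ 1ℚ + M * ((+ 2) / 1) →
  N + (1ℚ + M) ≤ n₁ + n₀ → ½ * (w * n₁) + (1ℚ - ½) * (w * n₀) ≤ e →
  ½ * w * ((+ 3) / 1 * M + (+ 2) / 1) ≤ e
nonAdaptive-arithmetic {w} {M} {n₁ = n₁} {n₀} 0≤w refl N≤ e≥ = ℚ.≤-trans
  (0≤⇒≤ (*-nonneg (*-nonneg 0≤½ 0≤w) (0≤ N≤))
    (solve 4 (λ w M a b → con ½ :* (w :* a) :+ (con 1ℚ :- con ½) :* (w :* b) :=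
       con ½ :* w :* (con ((+ 3) / 1) :* M :+ con ((+ 2) / 1)) :+
       con ½ :* w :* (a :+ b :- (con 1ℚ :+ M :* con ((+ 2) / 1) :+ (con 1ℚ :+ M)))) refl w M n₁ n₀))
  e≥

-- The saving over the full cost N = 2M + 1 is at least M on both likely outcomes, whose total
-- probability is w; hence the expected saving is at least wM.
adaptive-arithmetic : ∀ {w M N k₁ k₀ e} → 0ℚ ≤ w → N ≡ 1ℚ + M * ((+ 2) / 1) →
  k₁ ≤ 1ℚ + M → k₀ ≤ 1ℚ + M → ½ * (w * (N - k₁)) + (1ℚ - ½) * (w * (N - k₀)) ≤ N - e →
  e ≤ 1ℚ + (+ 2) / 1 * M - w * M
adaptive-arithmetic {w} {M} {_} {k₁} {k₀} {e} 0≤w refl k₁≤ k₀≤ e≤ =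
  0≤⇒≤ (+-nonneg (0≤ e≤) (*-nonneg (*-nonneg 0≤½ 0≤w) (+-nonneg (0≤ k₁≤) (0≤ k₀≤))))
    (solve 5 (λ w M a b X →
      let N = con 1ℚ :+ M :* con ((+ 2) / 1) in
      con 1ℚ :+ con ((+ 2) / 1) :* M :- w :* M :=
      X :+ (N :- X :- (con ½ :* (w :* (N :- a)) :+ (con 1ℚ :- con ½) :* (w :* (N :- b)))
              :+ con ½ :* w :* ((con 1ℚ :+ M :- a) :+ (con 1ℚ :+ M :- b)))) refl w M k₁ k₀ e)

-- Here η bounds the probability that some skewed test has its unlikely result.
gap-arithmetic : ∀ {ε M w η L X} → 0ℚ ≤ ε → 0ℚ ≤ M → 0ℚ ≤ η → 0ℚ ≤ L → 0ℚ ≤ X →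
  η * (1ℚ + M) ≤ 1ℚ → 1ℚ - η ≤ w → (+ 4) / 1 ≤ ε * M →
  ½ * w * ((+ 3) / 1 * M + (+ 2) / 1) ≤ L → X ≤ 1ℚ + (+ 2) / 1 * M - w * M →
  ((+ 3) / 2 - ε) * X ≤ L
gap-arithmetic {ε} {M} {w} {η} {L} {X} 0≤ε 0≤M 0≤η 0≤L 0≤X ηM≤1 w≥ εM≥4 L≥ X≤
  with ℚ.≤-total ε ((+ 3) / 2)
-- For ε ≥ 3/2 the factor 3/2 - ε is nonpositive while `X` and `L` are nonnegative.
... | inj₂ ≤ε = 0≤⇒≤ (+-nonneg (*-nonneg (0≤ ≤ε) 0≤X) 0≤L)
    (solve 3 (λ e x l → l := (con ((+ 3) / 2) :- e) :* x :+ ((e :- con ((+ 3) / 2)) :* x :+ l)) refl ε X L)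
-- By `X≤′` and `L≥′` the difference of the two sides is at least εM + 2ε - 7/2; the bound εM ≥ 4
-- absorbs the 7/2 and leaves ½.
... | inj₁ ε≤ =
  0≤⇒≤ (+-nonneg (+-nonneg (0≤ L≥′) (*-nonneg (0≤ ε≤) (0≤ X≤′)))
          (+-nonneg (+-nonneg (0≤ εM≥4) (+-nonneg 0≤ε 0≤ε)) 0≤½))
    (solve 4 (λ e M L X → L := (con ((+ 3) / 2) :- e) :* X :+
       ((L :- (con ((+ 3) / 2) :* M :- con ½)) :+ (con ((+ 3) / 2) :- e) :* ((M :+ con ((+ 2) / 1)) :- X)
         :+ ((e :* M :- con ((+ 4) / 1)) :+ (e :+ e) :+ con ½))) refl ε M L X)
  where
  -- Replacing w by 1 loses only ηM ≤ 1 here and η(3M + 2)/2 ≤ 3/2 in `L≥′`, both because η(1 + M) ≤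
  -- 1.
  X≤′ : X ≤ M + (+ 2) / 1
  X≤′ = 0≤⇒≤ (+-nonneg (+-nonneg (0≤ X≤) (*-nonneg (0≤ w≥) 0≤M)) (+-nonneg (0≤ ηM≤1) 0≤η))
    (solve 4 (λ M w h X → M :+ con ((+ 2) / 1) := X :+
      ((con 1ℚ :+ con ((+ 2) / 1) :* M :- w :* M) :- X :+ (w :- (con 1ℚ :- h)) :* M
        :+ ((con 1ℚ :- h :* (con 1ℚ :+ M)) :+ h))) refl M w η X)
  L≥′ : (+ 3) / 2 * M - ½ ≤ L
  L≥′ = 0≤⇒≤ (+-nonneg (+-nonneg (0≤ L≥) (*-nonneg (*-nonneg 0≤½ (0≤ w≥))
                   (+-nonneg (*-nonneg {(+ 3) / 1} (*≤* (ℤ.+≤+ z≤n)) 0≤M) (*≤* (ℤ.+≤+ z≤n)))))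
                 (+-nonneg (*-nonneg {(+ 3) / 2} (*≤* (ℤ.+≤+ z≤n)) (0≤ ηM≤1)) (*-nonneg 0≤½ 0≤η)))
    (solve 4 (λ M w h L → L := (con ((+ 3) / 2) :* M :- con ½) :+
      ((L :- con ½ :* w :* (con ((+ 3) / 1) :* M :+ con ((+ 2) / 1)))
       :+ con ½ :* (w :- (con 1ℚ :- h)) :* (con ((+ 3) / 1) :* M :+ con ((+ 2) / 1))
       :+ (con ((+ 3) / 2) :* (con 1ℚ :- h :* (con 1ℚ :+ M)) :+ con ½ :* h))) refl M w η L)

-- Case splits on the stopping rule, and cardinalities of sets of tests.

-- The cost functions branch on `does (determined? I S x)`; the explicit motive `P` splits on this
-- without abstracting the decision from the goal.
if-dec : ∀ {A : Set} (P : ℚ → Set) (A? : Dec A) {a b} → (A → P a) → (¬ A → P b) →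
         P (if does A? then a else b)
if-dec P (yes p) onYes onNo = onYes p
if-dec P (no ¬p) onYes onNo = onNo ¬p

∣remove∣ : ∀ {x : Subset n} {j} → j ∈ x → suc ∣ x [ j ]≔ false ∣ ≡ ∣ x ∣
∣remove∣ here = refl
∣remove∣ (there {y = true}  j∈x) = cong suc (∣remove∣ j∈x)
∣remove∣ (there {y = false} j∈x) = ∣remove∣ j∈x

∣insert∣ : ∀ (x : Subset n) {j} → j ∈ ∁ x → ∣ x [ j ]≔ true ∣ ≡ suc ∣ x ∣
∣insert∣ (false Vec.∷ x) {zero}  _ = refl
∣insert∣ (true  Vec.∷ x) {suc _} (there j∈∁x) = cong suc (∣insert∣ x j∈∁x)
∣insert∣ (false Vec.∷ x) {suc _} (there j∈∁x) = ∣insert∣ x j∈∁x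

∣∪⁅⁆∣≤ : ∀ (S : Subset n) j → ∣ S ∪ ⁅ j ⁆ ∣ ℕ.≤ suc ∣ S ∣
∣∪⁅⁆∣≤ (true  Vec.∷ S) zero rewrite Sub.∪-identityʳ S = ℕ.n≤1+n _
∣∪⁅⁆∣≤ (false Vec.∷ S) zero rewrite Sub.∪-identityʳ S = ℕ.≤-refl
∣∪⁅⁆∣≤ (true  Vec.∷ S) (suc j) = s≤s (∣∪⁅⁆∣≤ S j)
∣∪⁅⁆∣≤ (false Vec.∷ S) (suc j) = ∣∪⁅⁆∣≤ S j

∣∪⁅⁆∣> : ∀ (S : Subset n) {j} → j ∉ S → suc ∣ S ∣ ℕ.≤ ∣ S ∪ ⁅ j ⁆ ∣
∣∪⁅⁆∣> S {j} j∉S = Sub.p⊂q⇒∣p∣<∣q∣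
  (Sub.p⊆p∪q ⁅ j ⁆ , j , Sub.q⊆p∪q S ⁅ j ⁆ (Sub.x∈⁅x⁆ j) , j∉S)

elements : Subset n → List (Fin n)
elements Vec.[]            = []
elements (true  Vec.∷ s) = zero ∷ List.map suc (elements s)
elements (false Vec.∷ s) = List.map suc (elements s)

length-elements : (s : Subset n) → List.length (elements s) ≡ ∣ s ∣
length-elements Vec.[]            = refl
length-elements (true  Vec.∷ s) = cong suc (trans (List.length-map suc (elements s)) (length-elements s))
length-elements (false Vec.∷ s) = trans (List.length-map suc (elements s)) (length-elements s)

∈-elements : ∀ {s : Subset n} {j} → j ∈ s → j List.∈ elements s
∈-elements here = here refl
∈-elements (there {y = true}  j∈s) = there (List.∈-map⁺ suc (∈-elements j∈s))
∈-elements (there {y = false} j∈s) = List.∈-map⁺ suc (∈-elements j∈s)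

-- Certificates and the cost bounds that follow from them.

module _ (I : Instance n 2) where

  -- C is the set of tests that must be conducted to certify the score of x.
  Certificate : Subset n → Outcome n → Set
  Certificate C x = ∀ S → Determined I S x ⇔ C ⊆ S

  private
    k = t I (suc zero)

  score-≥ : ∀ x → k ℕ.≤ ∣ x ∣ → score I x ≡ suc zero
  score-≥ x k≤ = proj₂ (proj₂ (score-exists-unique I x))
    (k≤ , subst (∣ x ∣ ℕ.<_) (sym (t-last I)) (s≤s (Sub.∣p∣≤n x)))

  score-< : ∀ x → ∣ x ∣ ℕ.< k → score I x ≡ zero
  score-< x <k = proj₂ (proj₂ (score-exists-unique I x))
    (subst (ℕ._≤ ∣ x ∣) (sym (t-first I)) z≤n , <k)

  -- A pivotal test cannot be left out: if j were not in `S`, the changed outcome would agree with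
  -- `x` on `S` and yet have another score.
  determined⇒∈ : ∀ {S} x {j} b → Determined I S x → score I (x [ j ]≔ b) ≢ score I x → j ∈ S
  determined⇒∈ {S} x {j} b det flip with j ∈? S
  ... | yes j∈S = j∈S
  ... | no  j∉S = contradiction (det (x [ j ]≔ b) agree) flip
    where
    agree : Agree S x (x [ j ]≔ b)
    agree i i∈S = Vec.lookup∘updateAt′ i j (λ { refl → j∉S i∈S }) x

  -- With exactly k successes each of them is pivotal, and k observed successes settle the score
  -- whatever the other tests give.
  ones-certificate : ∀ {x} → ∣ x ∣ ≡ k → Certificate x x
  ones-certificate {x} ∣x∣≡k S = mk⇔
    (λ det {j} j∈x → determined⇒∈ x false det λ eq → Fin.0≢1+n (trans (sym
       (score-< (x [ j ]≔ false) (ℕ.≤-reflexive (trans (∣remove∣ j∈x) ∣x∣≡k)))) (trans eq high)))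
    (λ x⊆S x′ agree → trans
       (score-≥ x′ (subst (ℕ._≤ ∣ x′ ∣) ∣x∣≡k (Sub.p⊆q⇒∣p∣≤∣q∣ λ {j} j∈x →
          Vec.lookup⇒[]= j x′ (trans (agree j (x⊆S j∈x)) (Vec.[]=⇒lookup j∈x)))))
       (sym high))
    where
    high = score-≥ x (ℕ.≤-reflexive (sym ∣x∣≡k))

  -- With k - 1 successes every failure is pivotal. Once all failures are observed, a compatible
  -- outcome succeeds only where `x` does, so it stays below k.
  zeros-certificate : ∀ {x} → suc ∣ x ∣ ≡ k → Certificate (∁ x) x
  zeros-certificate {x} 1+∣x∣≡k S = mk⇔
    (λ det {j} j∈∁x → determined⇒∈ x true det λ eq → Fin.0≢1+n (trans (sym low) (trans (sym eq)
       (score-≥ (x [ j ]≔ true) (ℕ.≤-reflexive (sym (trans (∣insert∣ x j∈∁x) 1+∣x∣≡k)))))))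
    (λ ∁x⊆S x′ agree → trans
       (score-< x′ (subst (∣ x′ ∣ ℕ.<_) 1+∣x∣≡k (s≤s (Sub.p⊆q⇒∣p∣≤∣q∣ {p = x′} {x} (x′⊆x ∁x⊆S {x′} agree)))))
       (sym low))
    where
    low = score-< x (ℕ.≤-reflexive 1+∣x∣≡k)
    x′⊆x : ∁ x ⊆ S → ∀ {x′} → Agree S x x′ → x′ ⊆ x
    x′⊆x ∁x⊆S agree {j} j∈x′ with j ∈? x
    ... | yes j∈x = j∈x
    ... | no  j∉x = Vec.lookup⇒[]= j x
      (trans (sym (agree j (∁x⊆S (Sub.x∉p⇒x∈∁p j∉x)))) (Vec.[]=⇒lookup j∈x′))

  costFrom-determined : ∀ {S x} → Determined I S x → ∀ T → costFrom I S T x ≡ 0ℚ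
  costFrom-determined det (end _) = refl
  costFrom-determined {S} {x} det (test _ _ _) =
    if-dec (_≡ 0ℚ) (determined? I S x) (λ _ → refl) (λ ¬det → contradiction det ¬det)

  costInOrder-nonneg : ∀ S js x → 0ℚ ≤ costInOrder I S js x
  costInOrder-nonneg S []       x = ℚ.≤-refl
  costInOrder-nonneg S (j ∷ js) x = if-dec (0ℚ ≤_) (determined? I S x)
    (λ _ → ℚ.≤-refl) (λ _ → +-nonneg (c-nonneg I j) (costInOrder-nonneg (S ∪ ⁅ j ⁆) js x))

  costFrom-nonneg : ∀ {S} (T : AdaptiveFrom S) x → 0ℚ ≤ costFrom I S T x
  costFrom-nonneg (end _) x = ℚ.≤-refl
  costFrom-nonneg {S} (test j _ next) x = if-dec (0ℚ ≤_) (determined? I S x)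
    (λ _ → ℚ.≤-refl) (λ _ → +-nonneg (c-nonneg I j) (costFrom-nonneg (next (lookup x j)) x))

  module _ (unit : UnitCost I) where

    private
      shift : ∀ s j q → ι (suc s) + q ≡ ι s + (c I j + q)
      shift s j q rewrite unit j = trans (cong (_+ q) (ℚ.+-comm 1ℚ (ι s))) (ℚ.+-assoc (ι s) 1ℚ q)

      1+≤ : ∀ j {a b} → a ≤ b → 1ℚ + a ≤ c I j + b
      1+≤ j = ℚ.+-mono-≤ (ℚ.≤-reflexive (sym (unit j)))

      ≤1+ : ∀ j {a b} → a ≤ b → c I j + a ≤ 1ℚ + b
      ≤1+ j = ℚ.+-mono-≤ (ℚ.≤-reflexive (unit j))

      ι≤ι+0 : ∀ {a b} → a ℕ.≤ b → ι a ≤ ι b + 0ℚ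
      ι≤ι+0 {a} {b} a≤b = subst (ι a ≤_) (sym (ℚ.+-identityʳ (ι b))) (ι-mono a≤b)

      ι+0≤ι : ∀ {a b} → a ℕ.≤ b → ι a + 0ℚ ≤ ι b
      ι+0≤ι {a} {b} a≤b = subst (_≤ ι b) (sym (ℚ.+-identityʳ (ι a))) (ι-mono a≤b)

    -- Stopping forces `C ⊆ S`, so at least as many tests as `C` has were paid for; the length
    -- hypothesis covers a list that runs out. The counter `s` stands in for the size of `S` because
    -- the list may repeat tests.
    costInOrder-≥-certificate : ∀ {C x} → Certificate C x → ∀ S js s →
      ∣ S ∣ ℕ.≤ s → ∣ C ∣ ℕ.≤ s ℕ.+ List.length js → ι ∣ C ∣ ≤ ι s + costInOrder I S js x
    costInOrder-≥-certificate {C} cert S [] s S≤s C≤ =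
      ι≤ι+0 (subst (∣ C ∣ ℕ.≤_) (ℕ.+-identityʳ s) C≤)
    costInOrder-≥-certificate {C} {x} cert S (j ∷ js) s S≤s C≤ =
      if-dec (λ q → ι ∣ C ∣ ≤ ι s + q) (determined? I S x)
        (λ det → ι≤ι+0 (ℕ.≤-trans (Sub.p⊆q⇒∣p∣≤∣q∣ (Equivalence.to (cert S) det)) S≤s))
        (λ _ → subst (ι ∣ C ∣ ≤_) (shift s j _)
          (costInOrder-≥-certificate cert (S ∪ ⁅ j ⁆) js (suc s)
            (ℕ.≤-trans (∣∪⁅⁆∣≤ S j) (s≤s S≤s))
            (subst (∣ C ∣ ℕ.≤_) (ℕ.+-suc s (List.length js)) C≤)))

    -- The run cannot stop before `f i`, a missing member of the certificate, is conducted;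
    -- injectivity keeps it missing until position `i`. Positions count from 0, hence the `suc`.
    -- Separate `N` and `n` let the induction drop the head of the order.
    costInOrder-≥-position : ∀ {C x} → Certificate C x → (f : Fin N → Fin n) → Injective _≡_ _≡_ f →
      ∀ S i → f i ∈ C → f i ∉ S → ι (suc (toℕ i)) ≤ costInOrder I S (List.tabulate f) x
    costInOrder-≥-position {x = x} cert f inj S zero fi∈C fi∉S =
      if-dec (1ℚ + 0ℚ ≤_) (determined? I S x)
        (λ det → contradiction (Equivalence.to (cert S) det fi∈C) fi∉S)
        (λ _ → 1+≤ (f zero) (costInOrder-nonneg _ (List.tabulate (f ∘ suc)) x))
    costInOrder-≥-position {x = x} cert f inj S (suc i) fi∈C fi∉S =
      if-dec (ι (suc (suc (toℕ i))) ≤_) (determined? I S x)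
        (λ det → contradiction (Equivalence.to (cert S) det fi∈C) fi∉S)
        (λ _ → 1+≤ (f zero)
          (costInOrder-≥-position cert (f ∘ suc) (Fin.suc-injective ∘ inj) _ i fi∈C fi∉S∪))
      where
      fi∉S∪ : f (suc i) ∉ S ∪ ⁅ f zero ⁆
      fi∉S∪ fi∈ with Sub.x∈p∪q⁻ S ⁅ f zero ⁆ fi∈
      ... | inj₁ fi∈S  = fi∉S fi∈S
      ... | inj₂ fi∈f0 = Fin.0≢1+n (sym (inj (Sub.x∈⁅y⁆⇒x≡y _ fi∈f0)))

    -- Every test conducted enlarges `S`, which never exceeds n. This makes the saving nonnegative
    -- on every outcome, the unlikely ones included.
    costFrom-≤ : ∀ {S} (T : AdaptiveFrom S) x → ι ∣ S ∣ + costFrom I S T x ≤ ι n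
    costFrom-≤ {S} (end _) x = ι+0≤ι (Sub.∣p∣≤n S)
    costFrom-≤ {S} (test j j∉S next) x = if-dec (λ q → ι ∣ S ∣ + q ≤ ι n) (determined? I S x)
      (λ _ → ι+0≤ι (Sub.∣p∣≤n S))
      (λ _ → subst (_≤ ι n) (shift ∣ S ∣ j _)
        (ℚ.≤-trans (ℚ.+-monoˡ-≤ _ (ι-mono (∣∪⁅⁆∣> S j∉S))) (costFrom-≤ (next (lookup x j)) x)))

    test-cost : ∀ {S} j j∉S next x r → costFrom I (S ∪ ⁅ j ⁆) (next (lookup x j)) x ≤ ι r →
                costFrom I S (test j j∉S next) x ≤ ι (suc r)
    test-cost {S} j j∉S next x r le = if-dec (_≤ ι (suc r)) (determined? I S x)
      (λ _ → 0≤ι (suc r)) (λ _ → ≤1+ j le)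

-- Strategies that follow a list of tests.

pass : ∀ {S S′ : Subset n} {i js j} → S ⊆ S′ → i ∈ S′ → j ∈ S ⊎ j List.∈ (i ∷ js) → j ∈ S′ ⊎ j List.∈ js
pass S⊆S′ i∈S′ (inj₁ j∈S)          = inj₁ (S⊆S′ j∈S)
pass S⊆S′ i∈S′ (inj₂ (here refl))  = inj₁ i∈S′
pass S⊆S′ i∈S′ (inj₂ (there j∈js)) = inj₂ j∈js

∈-or-∈[] : ∀ {S : Subset n} {j} → j ∈ S ⊎ j List.∈ [] → j ∈ S
∈-or-∈[] (inj₁ j∈S) = j∈S

-- Tests already conducted are skipped, so a priority list can simply be followed by the list of all
-- tests, repetitions and all.
scan : ∀ js (S : Subset n) → (∀ j → j ∈ S ⊎ j List.∈ js) → AdaptiveFrom S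
scan []       S cover = end (∈-or-∈[] ∘ cover)
scan (i ∷ js) S cover with i ∈? S
... | yes i∈S = scan js S (pass id i∈S ∘ cover)
... | no  i∉S = test i i∉S λ _ → scan js (S ∪ ⁅ i ⁆)
  (pass (Sub.p⊆p∪q ⁅ i ⁆) (Sub.q⊆p∪q S ⁅ i ⁆ (Sub.x∈⁅x⁆ i)) ∘ cover)

-- After `js` the whole certificate has been conducted, so the score is determined and `js′` costs
-- nothing.
scan-cost : (I : Instance n 2) → UnitCost I → ∀ {C x} → Certificate I C x → ∀ js js′ S cover →
  (∀ j → j ∈ C → j ∈ S ⊎ j List.∈ js) →
  costFrom I S (scan (js ++ js′) S cover) x ≤ ι (List.length js)
scan-cost I unit cert [] js′ S cover C⊆ = ℚ.≤-reflexive
  (costFrom-determined I (Equivalence.from (cert S) λ {j} j∈C → ∈-or-∈[] (C⊆ j j∈C)) (scan js′ S cover))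
scan-cost I unit {x = x} cert (i ∷ js) js′ S cover C⊆ with i ∈? S
... | yes i∈S = ℚ.≤-trans
  (scan-cost I unit cert js js′ S (pass id i∈S ∘ cover) λ j j∈C → pass id i∈S (C⊆ j j∈C))
  (ι-mono (ℕ.n≤1+n (List.length js)))
... | no i∉S = 
  test-cost I unit i i∉S (λ _ → scan (js ++ js′) (S ∪ ⁅ i ⁆) (pass′ ∘ cover)) x (List.length js)
    (scan-cost I unit cert js js′ (S ∪ ⁅ i ⁆) (pass′ ∘ cover) λ j j∈C → pass′ (C⊆ j j∈C))
  where
  pass′ : ∀ {js j} → j ∈ S ⊎ j List.∈ (i ∷ js) → j ∈ S ∪ ⁅ i ⁆ ⊎ j List.∈ js
  pass′ = pass (Sub.p⊆p∪q ⁅ i ⁆) (Sub.q⊆p∪q S ⁅ i ⁆ (Sub.x∈⁅x⁆ i))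

-- Existence of optimal strategies by finite enumeration.

-- The list need only be complete up to the value of `F`: strategies contain functions and proofs,
-- so propositional equality would call for extensionality.
minimiser : ∀ {A : Set} (F : A → ℚ) → A → ∀ as → (∀ a → Any (λ a′ → F a′ ≡ F a) as) →
            Σ[ a ∈ A ] ∀ a′ → F a ≤ F a′
minimiser F ⊤ as complete = Extrema.argmin F ⊤ as , λ a →
  Extrema.f[argmin]≤v⁺ {f = F} ⊤ as (inj₂ (Any.map ℚ.≤-reflexive (complete a)))

permutations : ∀ n → List (Permutation′ n)
permutations zero    = Perm.id ∷ []
permutations (suc n) = List.cartesianProductWith (Perm.insert zero) (List.allFin (suc n)) (permutations n)

-- A permutation is recovered from the image of `zero` and the permutation that remains once `zero`
-- and that image are deleted.
permutations-complete : (π : Permutation′ n) → Any (_≈ π) (permutations n)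
permutations-complete {zero}  π = here λ ()
permutations-complete {suc n} π = Any.cartesianProductWith⁺ _ insert≈ (List.∈-allFin (π ⟨$⟩ʳ zero))
  (permutations-complete (Perm.remove zero π))
  where
  insert≈ : ∀ {j σ} → π ⟨$⟩ʳ zero ≡ j → σ ≈ Perm.remove zero π → Perm.insert zero j σ ≈ π
  insert≈ refl σ≈ zero = refl
  insert≈ {j} {σ} refl σ≈ (suc i) = begin
    Perm.insert zero j σ ⟨$⟩ʳ suc i                      ≡⟨ Perm.insert-punchIn zero j σ i ⟩
    punchIn j (σ ⟨$⟩ʳ i)                             ≡⟨ cong (punchIn j) (σ≈ i) ⟩
    punchIn j (Perm.remove zero π ⟨$⟩ʳ i)            ≡⟨ Perm.insert-punchIn zero j (Perm.remove zero π) i ⟨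
    Perm.insert zero j (Perm.remove zero π) ⟨$⟩ʳ suc i  ≡⟨ Perm.insert-remove zero π (suc i) ⟩
    π ⟨$⟩ʳ suc i                                          ∎
    where open ≡-Reasoning

optᴺ : (I : Instance n 2) → Σ[ π ∈ NonAdaptive n ] IsOPTᴺ I π
optᴺ {n} I = minimiser (λ π → 𝔼 I (costᴺ I π)) Perm.id (permutations n) λ π →
  Any.map (λ σ≈π → E-cong (p I) λ x → cong (λ js → costInOrder I ⊥ js x) (List.tabulate-cong σ≈π))
    (permutations-complete π)

ends : (S : Subset n) → List (AdaptiveFrom S)
ends S with Fin.all? (_∈? S)
... | yes full = end full ∷ []
... | no  _    = []

testing : (S : Subset n) (j : Fin n) → List (AdaptiveFrom (S ∪ ⁅ j ⁆)) → List (AdaptiveFrom S)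
testing S j Ts with j ∈? S
... | yes _   = []
... | no  j∉S = List.cartesianProductWith (λ T T′ → test j j∉S λ b → if b then T else T′) Ts Ts

-- The first argument is fuel that bounds the depth of the trees.
strategies : ℕ → (S : Subset n) → List (AdaptiveFrom S)
strategies         zero    S = ends S
strategies {n = n} (suc r) S =
  ends S ++ List.concatMap (λ j → testing S j (strategies r (S ∪ ⁅ j ⁆))) (List.allFin n)

module _ (I : Instance n 2) where

  infix 4 _≗ᶜ_
  _≗ᶜ_ : ∀ {S} → AdaptiveFrom S → AdaptiveFrom S → Set
  T ≗ᶜ T′ = ∀ x → costFrom I _ T x ≡ costFrom I _ T′ x

  ends-complete : ∀ {S} full → Any (_≗ᶜ end full) (ends S)
  ends-complete {S} full with Fin.all? (_∈? S)
  ... | yes _    = here λ _ → refl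
  ... | no ¬full = contradiction full ¬full

  testing-complete : ∀ {S} j j∉S next Ts → (∀ b → Any (_≗ᶜ next b) Ts) →
                     Any (_≗ᶜ test j j∉S next) (testing S j Ts)
  testing-complete {S} j j∉S next Ts complete with j ∈? S
  ... | yes j∈S = contradiction j∈S j∉S
  ... | no  _   = Any.cartesianProductWith⁺ _ (λ {T} {T′} T≗ T′≗ x → cong (λ q → if _ then 0ℚ else c I j + q)
                    (branch T T′ T≗ T′≗ (lookup x j) x)) (complete true) (complete false)
    where
    branch : ∀ T T′ → T ≗ᶜ next true → T′ ≗ᶜ next false → ∀ b → (if b then T else T′) ≗ᶜ next b
    branch _ _ T≗ T′≗ true  = T≗
    branch _ _ T≗ T′≗ false = T′≗

  -- Each test spends one unit of fuel and enlarges `S`, which preserves the hypothesis; with no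
  -- fuel left, `S` is full and no test remains.
  strategies-complete : ∀ r {S} → n ℕ.≤ ∣ S ∣ ℕ.+ r → (T : AdaptiveFrom S) →
                        Any (_≗ᶜ T) (strategies r S)
  strategies-complete zero    _ (end full) = ends-complete full
  strategies-complete (suc r) _ (end full) = Any.++⁺ˡ (ends-complete full)
  strategies-complete zero {S} n≤ (test j j∉S _) = contradiction
    (ℕ.≤-trans (∣∪⁅⁆∣> S j∉S) (ℕ.≤-trans (Sub.∣p∣≤n (S ∪ ⁅ j ⁆)) (subst (n ℕ.≤_) (ℕ.+-identityʳ ∣ S ∣) n≤)))
    (ℕ.<-irrefl refl)
  strategies-complete (suc r) {S} n≤ (test j j∉S next) = Any.++⁺ʳ (ends S)
    (Any.concatMap⁺ _ (Any.map (λ { refl → testing-complete j j∉S next _ λ b →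
        strategies-complete r n≤′ (next b) })
      (List.∈-allFin j)))
    where
    n≤′ : n ℕ.≤ ∣ S ∪ ⁅ j ⁆ ∣ ℕ.+ r
    n≤′ = ℕ.≤-trans n≤ (ℕ.≤-trans (ℕ.≤-reflexive (ℕ.+-suc ∣ S ∣ r)) (ℕ.+-monoˡ-≤ r (∣∪⁅⁆∣> S j∉S)))

  opt : Adaptive n → Σ[ T ∈ Adaptive n ] IsOPT I T
  opt T₀ = minimiser (λ T → 𝔼 I (cost I T)) T₀ (strategies n ⊥) λ T →
    Any.map (E-cong (p I)) (strategies-complete n (ℕ.m≤n+m n ∣ ⊥ {n} ∣) T)

-- The instance with a large gap.

sum-≥ : ∀ (f : Bool → ℚ) {a b} → (∀ x → a ≤ f x) → Σ[ x ∈ Bool ] b ≤ f x → b + a ≤ f true + f false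
sum-≥ f a≤ (true , b≤)          = ℚ.+-mono-≤ b≤ (a≤ false)
sum-≥ f {a} {b} a≤ (false , b≤) =
  ℚ.≤-trans (ℚ.≤-reflexive (ℚ.+-comm b a)) (ℚ.+-mono-≤ (a≤ true) b≤)

-- Both the likely result of the skewed tests and the set of those likely to succeed. The two kinds
-- are interleaved because `suc m ℕ.* 2` reduces to two successors, so no cast is required.
alternating : ∀ m → Subset (m ℕ.* 2)
alternating zero    = Vec.[]
alternating (suc m) = true Vec.∷ false Vec.∷ alternating m

∣alternating∣ : ∀ m → ∣ alternating m ∣ ≡ m
∣alternating∣ zero    = refl
∣alternating∣ (suc m) = cong suc (∣alternating∣ m)

∣∁alternating∣ : ∀ m → ∣ ∁ (alternating m) ∣ ≡ m
∣∁alternating∣ zero    = refl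
∣∁alternating∣ (suc m) = cong suc (∣∁alternating∣ m)

module Gap (m : ℕ) (δ : ℚ) (0<δ : 0ℚ < δ) (δ<1 : δ < 1ℚ) where

  tests : ℕ
  tests = suc (m ℕ.* 2)

  y : Subset (m ℕ.* 2)
  y = alternating m

  skewed : Bool → ℚ
  skewed b = if b then 1ℚ - δ else δ

  skewed-pos : ∀ b → 0ℚ < skewed b
  skewed-pos true  = subst (_< 1ℚ - δ) (ℚ.+-inverseʳ δ) (ℚ.+-monoˡ-< (- δ) δ<1)
  skewed-pos false = 0<δ

  skewed-<1 : ∀ b → skewed b < 1ℚ
  skewed-<1 true  = subst (1ℚ - δ <_) (ℚ.+-identityʳ 1ℚ) (ℚ.+-monoʳ-< 1ℚ (ℚ.neg-antimono-< 0<δ))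
  skewed-<1 false = δ<1

  prob : Fin tests → ℚ
  prob zero    = ½
  prob (suc j) = skewed (lookup y j)

  threshold : Fin 3 → ℕ
  threshold zero             = 0
  threshold (suc zero)       = suc m
  threshold (suc (suc zero)) = suc tests

  threshold-mono : ∀ {i j} → i Fin.< j → threshold i ℕ.< threshold j
  threshold-mono {zero}           {suc zero}       _ = s≤s z≤n
  threshold-mono {zero}           {suc (suc zero)} _ = s≤s z≤n
  threshold-mono {suc zero}       {suc (suc zero)} _ = s≤s (s≤s (ℕ.m≤m*n m 2))
  threshold-mono {suc zero}       {suc zero}       (s≤s ())
  threshold-mono {suc (suc zero)} {suc zero}       (s≤s ())
  threshold-mono {suc (suc zero)} {suc (suc zero)} (s≤s (s≤s ()))

  I : Instance tests 2
  I = record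
    { c        = λ _ → 1ℚ
    ; c-nonneg = λ _ → 0≤1
    ; p        = prob
    ; p-pos    = λ { zero → *<* (ℤ.+<+ (s≤s z≤n)) ; (suc j) → skewed-pos (lookup y j) }
    ; p-<1     = λ { zero → *<* (ℤ.+<+ (s≤s (s≤s z≤n))) ; (suc j) → skewed-<1 (lookup y j) }
    ; t        = threshold
    ; t-mono   = λ {i} {j} → threshold-mono {i} {j}
    ; t-first  = refl
    ; t-last   = refl
    }

  unit : UnitCost I
  unit _ = refl

  probability : Probability prob
  probability j = ℚ.<⇒≤ (p-pos I j) , ℚ.<⇒≤ (p-<1 I j)

  critical : Bool → Subset (m ℕ.* 2)
  critical b = if b then y else ∁ y

  ∣critical∣ : ∀ b → ∣ critical b ∣ ≡ m
  ∣critical∣ true  = ∣alternating∣ m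
  ∣critical∣ false = ∣∁alternating∣ m

  -- The likely outcomes lie on either side of the threshold, with k = m + 1 and k - 1 = m
  -- successes. The fair test is pivotal in both, hence the leading `true`.
  certificate : ∀ b → Certificate I (true Vec.∷ critical b) (b Vec.∷ y)
  certificate true  = ones-certificate I {true Vec.∷ y} (cong suc (∣alternating∣ m))
  certificate false = zeros-certificate I {false Vec.∷ y} (cong suc (∣alternating∣ m))

  critical-cover : ∀ j → Σ[ b ∈ Bool ] j ∈ true Vec.∷ critical b
  critical-cover zero = true , here
  critical-cover (suc j) with j ∈? y
  ... | yes j∈y = true , there j∈y
  ... | no  j∉y = false , there (Sub.x∉p⇒x∈∁p j∉y)

  module _ (π : NonAdaptive tests) where

    costᴺ-≥ : ∀ b → ι (suc m) ≤ costᴺ I π (b Vec.∷ y)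
    costᴺ-≥ b = subst (ι (suc m) ≤_) (ℚ.+-identityˡ (costᴺ I π (b Vec.∷ y)))
      (subst (λ s → ι (suc s) ≤ 0ℚ + costᴺ I π (b Vec.∷ y)) (∣critical∣ b)
        (costInOrder-≥-certificate I unit {x = b Vec.∷ y} (certificate b) ⊥ (List.tabulate (π ⟨$⟩ʳ_)) 0
          (ℕ.≤-reflexive (Sub.∣⊥∣≡0 tests))
          (subst (∣ true Vec.∷ critical b ∣ ℕ.≤_) (sym (List.length-tabulate (π ⟨$⟩ʳ_)))
            (Sub.∣p∣≤n (true Vec.∷ critical b)))))

    π-injective : Injective _≡_ _≡_ (π ⟨$⟩ʳ_)
    π-injective {i} {j} eq = trans (sym (Perm.inverseˡ π)) (trans (cong (π ⟨$⟩ˡ_) eq) (Perm.inverseˡ π))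

    -- The two certificates together cover all tests, so the last test of any order lies in one of
    -- them, and the matching outcome runs the order to its end.
    costᴺ-last : Σ[ b ∈ Bool ] ι tests ≤ costᴺ I π (b Vec.∷ y)
    costᴺ-last =
      let last = fromℕ (m ℕ.* 2)
          b , last∈C = critical-cover (π ⟨$⟩ʳ last)
      in b , subst (λ i → ι (suc i) ≤ costᴺ I π (b Vec.∷ y)) (Fin.toℕ-fromℕ (m ℕ.* 2))
        (costInOrder-≥-position I unit (certificate b) (π ⟨$⟩ʳ_) π-injective ⊥ last last∈C Sub.∉⊥)

    costᴺ-sum : ι tests + ι (suc m) ≤ costᴺ I π (true Vec.∷ y) + costᴺ I π (false Vec.∷ y)
    costᴺ-sum = sum-≥ (λ b → costᴺ I π (b Vec.∷ y)) costᴺ-≥ costᴺ-last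

  order : Bool → List (Fin tests)
  order b = elements (false Vec.∷ critical b)

  order-cover : ∀ b j → j ∈ ⊥ ∪ ⁅ zero ⁆ ⊎ j List.∈ (order b ++ List.allFin tests)
  order-cover b j = inj₂ (List.∈-++⁺ʳ (order b) (List.∈-allFin j))

  -- The critical tests come first; the appended list of all tests completes the tree and is never
  -- reached on the two likely outcomes.
  branch : Bool → AdaptiveFrom (⊥ ∪ ⁅ zero ⁆)
  branch b = scan (order b ++ List.allFin tests) (⊥ ∪ ⁅ zero ⁆) (order-cover b)

  probe : Adaptive tests
  probe = test zero Sub.∉⊥ branch

  probe-cost : ∀ b → cost I probe (b Vec.∷ y) ≤ ι (suc m)
  probe-cost b = test-cost I unit zero Sub.∉⊥ branch (b Vec.∷ y) m
    (subst (λ l → costFrom I (⊥ ∪ ⁅ zero ⁆) (branch b) (b Vec.∷ y) ≤ ι l)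
      (trans (length-elements (false Vec.∷ critical b)) (∣critical∣ b))
      (scan-cost I unit (certificate b) (order b) (List.allFin tests) (⊥ ∪ ⁅ zero ⁆) (order-cover b) C⊆))
    where
    C⊆ : ∀ j → j ∈ true Vec.∷ critical b → j ∈ ⊥ ∪ ⁅ zero ⁆ ⊎ j List.∈ order b
    C⊆ zero    _           = inj₁ here
    C⊆ (suc j) (there j∈C) = inj₂ (∈-elements (there j∈C))

  w : ℚ
  w = weight (prob ∘ suc) y

  0≤w : 0ℚ ≤ w
  0≤w = weight-nonneg (prob ∘ suc) (probability ∘ suc) y

  ι-tests : ι tests ≡ 1ℚ + ι m * ((+ 2) / 1)
  ι-tests = cong (_+_ 1ℚ) (ι-* m 2)

  𝔼-costᴺ-≥ : ∀ π → ½ * w * ((+ 3) / 1 * ι m + (+ 2) / 1) ≤ 𝔼 I (costᴺ I π)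
  𝔼-costᴺ-≥ π = nonAdaptive-arithmetic {M = ι m} 0≤w ι-tests (costᴺ-sum π)
    (branches≤E prob probability (costInOrder-nonneg I ⊥ (List.tabulate (π ⟨$⟩ʳ_))) y)

  -- `branches≤E` only bounds from below, so it is applied to the saving `ι tests - cost I probe x`.
  𝔼-probe-≤ : 𝔼 I (cost I probe) ≤ 1ℚ + (+ 2) / 1 * ι m - w * ι m
  𝔼-probe-≤ = adaptive-arithmetic {M = ι m} 0≤w ι-tests (probe-cost true) (probe-cost false)
    (ℚ.≤-trans (branches≤E prob probability saved y)
      (ℚ.≤-reflexive (E-complement prob (cost I probe) (ι tests))))
    where
    saved : ∀ x → 0ℚ ≤ ι tests - cost I probe x
    saved x = 0≤ (ℚ.≤-trans
      (ℚ.≤-reflexive (trans (sym (ℚ.+-identityˡ (cost I probe x)))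
        (cong (λ s → ι s + cost I probe x) (sym (Sub.∣⊥∣≡0 tests)))))
      (costFrom-≤ I unit probe x))

  module _ {η} (0≤η : 0ℚ ≤ η) (η-small : η * (1ℚ + ι m) ≤ 1ℚ) (w≥ : 1ℚ - η ≤ w)
           {ε} (0≤ε : 0ℚ ≤ ε) (4≤εm : (+ 4) / 1 ≤ ε * ι m) where

    -- The lower bound holds for every order `π`; optimality of `T` enters through the comparison
    -- with `probe`.
    gap : ∀ π T → IsOPT I T → ((+ 3) / 2 - ε) * 𝔼 I (cost I T) ≤ 𝔼 I (costᴺ I π)
    gap π T T-opt = gap-arithmetic 0≤ε (0≤ι m) 0≤η
      (E-nonneg prob probability (costInOrder-nonneg I ⊥ (List.tabulate (π ⟨$⟩ʳ_))))
      (E-nonneg prob probability (costFrom-nonneg I T))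
      η-small w≥ 4≤εm (𝔼-costᴺ-≥ π) (ℚ.≤-trans (T-opt probe) 𝔼-probe-≤)

theorem3 : (ε : ℚ) → 0ℚ < ε →
    Σ[ n ∈ ℕ ] Σ[ k ∈ ℕ ] Σ[ I ∈ Instance n 2 ] IsKOfN k I × UnitCost I ×
    (Σ[ π ∈ NonAdaptive n ] Σ[ T ∈ Adaptive n ] IsOPTᴺ I π × IsOPT I T ×
    𝔼 I (costᴺ I π) ≥ ((+ 3) / 2 - ε) * 𝔼 I (cost I T))
theorem3 ε 0<ε =
  tests , suc m , I , refl , unit , π , T , π-opt , T-opt ,
  gap (*-nonneg (0≤ι (m ℕ.* 2)) 0≤δ) η-small (bernoulli 0≤δ (ℚ.<⇒≤ δ<1) y) (ℚ.<⇒≤ 0<ε) 4≤εm π T T-opt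
  where
  d    = proj₁ (archimedean ε 0<ε)
  1≤εd = proj₂ (archimedean ε 0<ε)
  -- From εd ≥ 1 this gives εm ≥ 4, as `gap` requires.
  m    = 4 ℕ.* d
  -- So δ = 1/(2m(m + 1) + 2). Then η = 2mδ, the loss in Bernoulli's inequality, satisfies η(m + 1)
  -- ≤ 1, and the summand 2 keeps δ below 1.
  δ-reciprocal = reciprocal (suc (m ℕ.* 2 ℕ.* suc m))
  δ    = proj₁ δ-reciprocal
  0<δ  = proj₁ (proj₂ δ-reciprocal)
  0≤δ  = ℚ.<⇒≤ 0<δ
  δ<1  = reciprocal-<1 (m ℕ.* 2 ℕ.* suc m) 0<δ (proj₂ (proj₂ δ-reciprocal))
  open Gap m δ 0<δ δ<1
  π     = proj₁ (optᴺ I)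
  π-opt = proj₂ (optᴺ I)
  T     = proj₁ (opt I probe)
  T-opt = proj₂ (opt I probe)
  η-small : ι (m ℕ.* 2) * δ * (1ℚ + ι m) ≤ 1ℚ
  η-small = 0≤⇒≤ (+-nonneg 0≤δ 0≤δ)
    (trans (sym (proj₂ (proj₂ δ-reciprocal)))
      (trans (cong (λ q → δ * (1ℚ + (1ℚ + q))) (ι-* (m ℕ.* 2) (suc m)))
        (solve 3 (λ d a b → d :* (con 1ℚ :+ (con 1ℚ :+ a :* b)) := a :* d :* b :+ (d :+ d)) refl
          δ (ι (m ℕ.* 2)) (ι (suc m)))))
  4≤εm : (+ 4) / 1 ≤ ε * ι m
  4≤εm = 0≤⇒≤ (*-nonneg (0≤ι 4) (0≤ 1≤εd))
    (trans (cong (ε *_) (ι-* 4 d)) (solve 2 (λ e d → e :* (con ((+ 4) / 1) :* d) :=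
      con ((+ 4) / 1) :+ con ((+ 4) / 1) :* (e :* d :- con 1ℚ)) refl ε (ι d)))
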